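{- Let $d(u_i,u_j)$ denote the minimal number of diagonal-flips needed to transform the triangulation of the convex $(n+2)$-gon corresponding to the generator $u_i$ of the Temperley-Lieb algebra $TL_n$ into the triangulation corresponding to the generator $u_j$. Let $1\le i\le n-1$ and let $k\ge 2$ be an integer. Then, whenever the indices of the generators involved lie in $\{1,\dots,n-1\}$, $$d(u_i,u_{i+1})=\begin{cases}3 & \text{if } i\ne n-2,\\ 2 & \text{if } i=n-2,\end{cases}\qquad d(u_i,u_{i+k})=\begin{cases}k+1 & \text{if } i\ne n-k-1,\\ k & \text{if } i=n-k-1,\end{cases}$$ $$d(u_i,u_{i-1})=\begin{cases}3 & \text{if } i\ne n-1,\\ 2 & \text{if } i=n-1,\end{cases}\qquad d(u_i,u_{i-k})=\begin{cases}k+1 & \text{if } i\ne n-1,\\ k & \text{if } i=n-1.\end{cases}$$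
   Context: Generators: $u_i$ ($1\le i\le n-1$) is identified with the following plane perfect matching on vertices $v_1,\dots,v_{2n}$, placed in two parallel rows of $n$ vertices, labeled in clockwise order with $v_1,\dots,v_n$ on top (left to right) and $v_{n+1},\dots,v_{2n}$ at the bottom (right to left, so that $v_{2n+1-j}$ lies below $v_j$): the edges are $v_iv_{i+1}$, $v_{2n-i}v_{2n-i+1}$, and $v_jv_{2n+1-j}$ for all $j\in\{1,\dots,n\}\setminus\{i,i+1\}$. Corresponding triangulation: direct every matching edge $v_av_b$, $a<b$, from $v_a$ to $v_b$, and let $B=(b_1,\dots,b_{2n})$ be the resulting 0/1 outdegree sequence. For a triangulation of a convex $(n+2)$-gon with points $p_1,\dots,p_{n+2}$ in clockwise order, direct edges from lower to higher index and let $D=(d_1,\dots,d_n)$, where $d_i$ is the outdegree of $p_i$ counting all diagonals and the boundary edge $p_1p_{n+2}$, but no other boundary edge. Both sequences determine their graph. The triangulation corresponding to a matching is the one for which $d_1$ is the number of 1s before the first 0 in $B$ and, for $2\le i\le n$, $d_i$ is the number of 1s between the $(i-1)$-st 0 and the $i$-th 0 of $B$. This is a bijection between plane perfect matchings on $2n$ vertices in convex position and triangulations of the convex $(n+2)$-gon. A diagonal-flip of a triangulation removes one diagonal and replaces it by the other diagonal of the convex quadrilateral formed by its two incident triangles. -}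

module Defs where

open import Data.List.Base using (List; []; _∷_; length; filter; map; upTo)
open import Data.Nat.Base using (ℕ; zero; suc; _+_; _*_; _∸_; _≤_; _<_)
open import Data.Nat.Properties using (_≟_; _≤?_)
open import Data.Product using (Σ; ∃; ∃!; _×_; _,_; proj₁)
open import Data.Sum using (_⊎_)
open import Function.Bundles using (_⇔_)
open import Relation.Binary.Core using (Rel)
open import Relation.Binary.Definitions using (Decidable)
open import Relation.Binary.PropositionalEquality using (_≡_; _≢_)
open import Relation.Nullary using (¬_; ¬?)
open import Relation.Nullary.Decidable using (_×-dec_; _⊎-dec_)
open import Level using (0ℓ)

-- Points are named by the labels 1, …, N of the text, in clockwise order.
labels : ℕ → List ℕ
labels N = map suc (upTo N)

-- A graph on N points in convex position, every edge directed from the lower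
-- to the higher label: Edge a b stands for the undirected edge ab with a < b.
record Graph (N : ℕ) : Set₁ where
  field
    Edge  : Rel ℕ 0ℓ
    edge? : Decidable Edge

  outdegree : ℕ → ℕ
  outdegree a = length (filter (edge? a) (labels N))

-- For a < b and c < d: the chords ab and cd meet in their interiors.
Crosses : ℕ → ℕ → ℕ → ℕ → Set
Crosses a b c d = (a < c × c < b × b < d) ⊎ (c < a × a < d × d < b)

-- The matching of the generator u_i of TL_n (meaningful for 1 ≤ i ≤ n - 1).
u : (n i : ℕ) → Graph (2 * n)
u n i = record { Edge = E ; edge? = e? }
  where
  E : Rel ℕ 0ℓ
  E a b = (a ≡ i × b ≡ i + 1)
        ⊎ (a ≡ 2 * n ∸ i × b ≡ 2 * n ∸ i + 1)
        ⊎ (1 ≤ a × a ≤ n × a ≢ i × a ≢ i + 1 × b ≡ 2 * n + 1 ∸ a)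

  e? : Decidable E
  e? a b = (a ≟ i ×-dec b ≟ i + 1)
     ⊎-dec (a ≟ 2 * n ∸ i ×-dec b ≟ 2 * n ∸ i + 1)
     ⊎-dec (1 ≤? a ×-dec a ≤? n ×-dec ¬? (a ≟ i) ×-dec ¬? (a ≟ i + 1)
            ×-dec b ≟ 2 * n + 1 ∸ a)

-- A triangulation is a maximal set of pairwise noncrossing chords.
-- By maximality the boundary edges of the polygon belong to Edge.
record Triangulation (N : ℕ) : Set₁ where
  field
    graph : Graph N
  open Graph graph public using (Edge; edge?)
  field
    ordered     : ∀ {a b} → Edge a b → 1 ≤ a × a < b × b ≤ N
    noncrossing : ∀ {a b c d} → Edge a b → Edge c d → ¬ Crosses a b c d
    maximal     : ∀ {a b} → 1 ≤ a → a < b → b ≤ N →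
                  (∀ {c d} → Edge c d → ¬ Crosses a b c d) → Edge a b

  -- Of the boundary edges only the one from 1 to N is counted; all others
  -- join consecutive labels.
  diagonalOutdegree : ℕ → ℕ
  diagonalOutdegree a =
    length (filter (λ b → edge? a b ×-dec ¬? (b ≟ suc a)) (labels N))

open Triangulation using (Edge)

_≈_ : ∀ {N} → Triangulation N → Triangulation N → Set
T ≈ T′ = ∀ a b → Edge T a b ⇔ Edge T′ a b

B : ∀ {N} → Graph N → List ℕ
B {N} M = map (Graph.outdegree M) (labels N)

D : ∀ n → Triangulation (2 + n) → List ℕ
D n T = map (Triangulation.diagonalOutdegree T) (labels n)

-- The numbers of 1s before the first 0 and between successive 0s, where c
-- counts the 1s read since the last 0.
runsFrom : ℕ → List ℕ → List ℕ
runsFrom c []           = []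
runsFrom c (zero  ∷ bs) = c ∷ runsFrom 0 bs
runsFrom c (suc _ ∷ bs) = runsFrom (suc c) bs

runs : List ℕ → List ℕ
runs = runsFrom 0

Corresponds : ∀ n → Graph (2 * n) → Triangulation (2 + n) → Set
Corresponds n M T = D n T ≡ runs (B M)

TheTriangulationOf : ∀ n → Graph (2 * n) → Set₁
TheTriangulationOf n M = ∃! _≈_ (Corresponds n M)

Replaces : ∀ {N} → Triangulation N → ℕ × ℕ → ℕ × ℕ → Triangulation N → Set
Replaces T e f T′ =
  ∀ a b → Edge T′ a b ⇔ ((Edge T a b × (a , b) ≢ e) ⊎ (a , b) ≡ f)

-- The sides force w < x < y < z.  In a triangulation of a convex polygon any
-- three pairwise adjacent vertices span a triangle, so either diagonal of wxyz
-- that is present has its two incident triangles inside wxyz.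
Flip : ∀ {N} → Triangulation N → Triangulation N → Set
Flip T T′ = ∃ λ w → ∃ λ x → ∃ λ y → ∃ λ z →
  (Edge T w x × Edge T x y × Edge T y z × Edge T w z) ×
  ((Edge T w y × Replaces T (w , y) (x , z) T′) ⊎
   (Edge T x z × Replaces T (x , z) (w , y) T′))

data Flips {N : ℕ} : ℕ → Triangulation N → Triangulation N → Set₁ where
  done : ∀ {T T′} → T ≈ T′ → Flips 0 T T′
  step : ∀ {m T T′ T″} → Flip T T′ → Flips m T′ T″ → Flips (suc m) T T″

FlipDistance : ∀ {N} → Triangulation N → Triangulation N → ℕ → Set₁
FlipDistance T T′ m = Flips m T T′ × (∀ {m′} → Flips m′ T T′ → m ≤ m′)

-- The flip distance between the triangulations corresponding to u_i and u_j
-- is m.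
d[_]⟨_,_⟩≡_ : (n i j m : ℕ) → Set₁
d[ n ]⟨ i , j ⟩≡ m =
  Σ (TheTriangulationOf n (u n i)) λ T →
  Σ (TheTriangulationOf n (u n j)) λ T′ →
  FlipDistance (proj₁ T) (proj₁ T′) m

{-# OPTIONS --safe #-}

-- A flip creates at most one edge, so the number of edges of the target that
-- are absent from the source bounds the flip distance from below; here this
-- bound is attained. With s = n - 1 - i, the triangulation of u_i has the
-- spokes from vertex 1 to s + 4, …, n + 2, the spokes from vertex 2 to
-- 4, …, s + 2 and s + 4, and the chord from s + 2 to s + 4 cutting off the ear
-- s + 3. It is one flip away from a double fan (vertex 1 joined to p, …, n + 2
-- and vertex 2 to 3, …, p), and lowering p by one is again a flip. For distant
-- generators the fan with p = s + 4 is bypassed: flipping the last spoke of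
-- vertex 2 and then the ear chord reaches the fan with p = s + 2 in two flips.
-- The special values for s = 0 come from the ear chord being then a spoke of 2.
module Submission where

open import Data.List.Base using (List; []; _∷_; _++_; length; filter; map; applyUpTo; replicate)
open import Data.List.Properties using
  (map-applyUpTo; filter-all; filter-none; filter-accept; filter-reject; length-applyUpTo; ∷-injective)
open import Data.List.Relation.Unary.All using (All; []; _∷_)
import Data.List.Relation.Unary.All as All
import Data.List.Relation.Unary.All.Properties as All
open import Data.List.Relation.Unary.AllPairs using ([]; _∷_)
open import Data.List.Relation.Unary.Any using (here; there)
open import Data.List.Relation.Unary.Unique.Propositional using (Unique)
import Data.List.Relation.Unary.Unique.Propositional.Properties as Unique
open import Data.List.Membership.Propositional using (_∈_)
open import Data.List.Membership.Propositional.Properties using (∈-map⁺; ∈-upTo⁺; ∈-filter⁺; ∈-length)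
open import Data.Nat.Base using (ℕ; zero; suc; _+_; _*_; _∸_; _≤_; _<_; z≤n; s≤s; z<s)
open import Data.Nat.Properties
open import Data.Product using (∃; _×_; _,_; proj₁; proj₂)
open import Data.Product.Properties using (≡-dec)
open import Data.Sum using (_⊎_; inj₁; inj₂; swap)
open import Function.Base using (_∘_; id)
open import Function.Bundles using (_⇔_; mk⇔; Equivalence)
open import Relation.Binary.Definitions using (tri<; tri≈; tri>)
open import Relation.Binary.PropositionalEquality using (_≡_; _≢_; refl; sym; trans; cong; cong₂; subst; ≢-sym; module ≡-Reasoning)
open import Relation.Nullary using (¬_; Dec; yes; no; contradiction; ¬?)
open import Relation.Nullary.Decidable using (_×-dec_; _⊎-dec_)
open import Relation.Unary using (Pred) renaming (Decidable to Decidable₁)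
open import Level using (0ℓ)
open import Data.Nat.Tactic.RingSolver using (solve-∀)
open import Defs

open Equivalence using (to; from)
open Triangulation using (Edge; edge?; ordered; noncrossing; maximal; diagonalOutdegree)

private variable
  N n : ℕ

-- Chords and inclusion of triangulations.

_≟ₑ_ : (e f : ℕ × ℕ) → Dec (e ≡ f)
_≟ₑ_ = ≡-dec _≟_ _≟_

crosses? : ∀ a b c d → Dec (Crosses a b c d)
crosses? a b c d = (a <? c ×-dec c <? b ×-dec b <? d) ⊎-dec (c <? a ×-dec a <? d ×-dec d <? b)

_∈ₑ_ : ℕ × ℕ → Triangulation N → Set
(a , b) ∈ₑ T = Edge T a b

consecutive-uncrossed : ∀ {a c d} → ¬ Crosses a (suc a) c d
consecutive-uncrossed (inj₁ (a<c , c<1+a , _)) = <⇒≱ c<1+a a<c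
consecutive-uncrossed (inj₂ (_ , a<d , d<1+a)) = <⇒≱ d<1+a a<d

boundary : (T : Triangulation N) → ∀ {a} → 1 ≤ a → a < N → Edge T a (suc a)
boundary T 1≤a a<N = maximal T 1≤a ≤-refl a<N λ _ → consecutive-uncrossed

_⊑_ : Triangulation N → Triangulation N → Set
T ⊑ T′ = ∀ {a b} → Edge T a b → Edge T′ a b

-- A chord of `T′` crosses no chord of `T′`, in particular none of `T`, so it lies in `T` by
-- maximality.
⊑⇒⊒ : (T T′ : Triangulation N) → T ⊑ T′ → T′ ⊑ T
⊑⇒⊒ T T′ T⊑T′ ab = let 1≤a , a<b , b≤N = ordered T′ ab in
  maximal T 1≤a a<b b≤N λ cd → noncrossing T′ ab (T⊑T′ cd)

-- Flips

record Quadrilateral (T : Triangulation N) (w x y z : ℕ) : Set where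
  constructor quad
  field
    wx : Edge T w x
    xy : Edge T x y
    yz : Edge T y z
    wz : Edge T w z

  w<x = proj₁ (proj₂ (ordered T wx))
  x<y = proj₁ (proj₂ (ordered T xy))
  y<z = proj₁ (proj₂ (ordered T yz))

-- Indexed by the removed and the inserted diagonal, so that both directions of a flip share the
-- proofs below.
data Diagonals (w x y z : ℕ) : (e f : ℕ × ℕ) → Set where
  wy→xz : Diagonals w x y z (w , y) (x , z)
  xz→wy : Diagonals w x y z (x , z) (w , y)

opposite : ∀ {w x y z e f} → Diagonals w x y z e f → Diagonals w x y z f e
opposite wy→xz = xz→wy
opposite xz→wy = wy→xz

module _ {w x y z : ℕ} (w<x : w < x) (x<y : x < y) (y<z : y < z) where

  diagonals-cross : ∀ {e f} → Diagonals w x y z e f →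
    Crosses (proj₁ e) (proj₂ e) (proj₁ f) (proj₂ f)
  diagonals-cross wy→xz = inj₁ (w<x , x<y , y<z)
  diagonals-cross xz→wy = inj₂ (w<x , x<y , y<z)

  -- A chord crossing one diagonal passes through the quadrilateral; crossing no side, it can only
  -- end at the two vertices off that diagonal.
  crosses-diagonal⇒other : ∀ {e f} → Diagonals w x y z e f → ∀ {c d} →
    ¬ Crosses c d w x → ¬ Crosses c d x y → ¬ Crosses c d y z → ¬ Crosses c d w z →
    Crosses c d (proj₁ e) (proj₂ e) → (c , d) ≡ f
  crosses-diagonal⇒other wy→xz _ _ _ ¬wz (inj₁ (c<w , w<d , d<y)) =
    contradiction (inj₁ (c<w , w<d , <-trans d<y y<z)) ¬wz
  crosses-diagonal⇒other wy→xz {c} {d} ¬wx ¬xy ¬yz ¬wz (inj₂ (w<c , c<y , y<d))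
    with <-cmp d z | <-cmp c x
  ... | tri< d<z _ _  | _ = contradiction (inj₁ (c<y , y<d , d<z)) ¬yz
  ... | tri> _ _ z<d  | _ = contradiction (inj₂ (w<c , <-trans c<y y<z , z<d)) ¬wz
  ... | tri≈ _ refl _ | tri< c<x _ _  = contradiction (inj₂ (w<c , c<x , <-trans x<y y<d)) ¬wx
  ... | tri≈ _ refl _ | tri> _ _ x<c  = contradiction (inj₂ (x<c , c<y , y<d)) ¬xy
  ... | tri≈ _ refl _ | tri≈ _ refl _ = refl
  crosses-diagonal⇒other xz→wy {c} {d} ¬wx ¬xy ¬yz ¬wz (inj₁ (c<x , x<d , d<z))
    with <-cmp c w | <-cmp d y
  ... | tri< c<w _ _  | _ = contradiction (inj₁ (c<w , <-trans w<x x<d , d<z)) ¬wz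
  ... | tri> _ _ w<c  | _ = contradiction (inj₂ (w<c , c<x , x<d)) ¬wx
  ... | tri≈ _ refl _ | tri< d<y _ _  = contradiction (inj₁ (c<x , x<d , d<y)) ¬xy
  ... | tri≈ _ refl _ | tri> _ _ y<d  = contradiction (inj₁ (<-trans c<x x<y , y<d , d<z)) ¬yz
  ... | tri≈ _ refl _ | tri≈ _ refl _ = refl
  crosses-diagonal⇒other xz→wy _ _ _ ¬wz (inj₂ (x<c , c<z , z<d)) =
    contradiction (inj₂ (<-trans w<x x<c , c<z , z<d)) ¬wz

  wx≢ : ∀ {e f} → Diagonals w x y z e f → (w , x) ≢ e
  wx≢ wy→xz refl = <-irrefl refl x<y
  wx≢ xz→wy refl = <-irrefl refl w<x

  xy≢ : ∀ {e f} → Diagonals w x y z e f → (x , y) ≢ e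
  xy≢ wy→xz refl = <-irrefl refl w<x
  xy≢ xz→wy refl = <-irrefl refl y<z

  yz≢ : ∀ {e f} → Diagonals w x y z e f → (y , z) ≢ e
  yz≢ wy→xz refl = <-irrefl refl y<z
  yz≢ xz→wy refl = <-irrefl refl x<y

  wz≢ : ∀ {e f} → Diagonals w x y z e f → (w , z) ≢ e
  wz≢ wy→xz refl = <-irrefl refl y<z
  wz≢ xz→wy refl = <-irrefl refl w<x

Exchanged : Triangulation N → (e f : ℕ × ℕ) → ℕ → ℕ → Set
Exchanged T e f a b = (Edge T a b × (a , b) ≢ e) ⊎ (a , b) ≡ f

module _ (T : Triangulation N) {w x y z : ℕ} (Q : Quadrilateral T w x y z) where
  open Quadrilateral Q

  diagonal-ordered : ∀ {e f} → Diagonals w x y z e f →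
    1 ≤ proj₁ f × proj₁ f < proj₂ f × proj₂ f ≤ N
  diagonal-ordered wy→xz = proj₁ (ordered T xy) , <-trans x<y y<z , proj₂ (proj₂ (ordered T yz))
  diagonal-ordered xz→wy = proj₁ (ordered T wx) , <-trans w<x x<y , proj₂ (proj₂ (ordered T xy))

  module _ {e f : ℕ × ℕ} (δ : Diagonals w x y z e f) where

    old-uncrossed : ∀ {c d} → Edge T c d → (c , d) ≢ e → ¬ Crosses c d (proj₁ f) (proj₂ f)
    old-uncrossed cd cd≢e = cd≢e ∘ crosses-diagonal⇒other w<x x<y y<z (opposite δ)
      (noncrossing T cd wx) (noncrossing T cd xy) (noncrossing T cd yz) (noncrossing T cd wz)

    flip : Triangulation N
    flip = record
      { graph       = record { Edge = Exchanged T e f ; edge? = λ a b →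
                        (edge? T a b ×-dec ¬? ((a , b) ≟ₑ e)) ⊎-dec ((a , b) ≟ₑ f) }
      ; ordered     = λ { (inj₁ (ab , _)) → ordered T ab ; (inj₂ refl) → diagonal-ordered δ }
      ; noncrossing = nc
      ; maximal     = max
      }
      where
      nc : ∀ {a b c d} → Exchanged T e f a b → Exchanged T e f c d → ¬ Crosses a b c d
      nc (inj₁ (ab , _))    (inj₁ (cd , _))    = noncrossing T ab cd
      nc (inj₁ (ab , ab≢e)) (inj₂ refl)        = old-uncrossed ab ab≢e
      nc (inj₂ refl)        (inj₁ (cd , cd≢e)) = old-uncrossed cd cd≢e ∘ swap
      nc (inj₂ refl)        (inj₂ refl) (inj₁ (a<a , _)) = <-irrefl refl a<a
      nc (inj₂ refl)        (inj₂ refl) (inj₂ (a<a , _)) = <-irrefl refl a<a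

      max : ∀ {a b} → 1 ≤ a → a < b → b ≤ N →
        (∀ {c d} → Exchanged T e f c d → ¬ Crosses a b c d) → Exchanged T e f a b
      -- A chord crossing `e` still misses the four sides, which survive the exchange, and so equals
      -- `f`. Any other misses all of `T` and lies in `T`; it is not `e`, because `e` crosses `f`.
      max {a} {b} 1≤a a<b b≤N free with crosses? a b (proj₁ e) (proj₂ e)
      ... | yes ab×e = inj₂ (crosses-diagonal⇒other w<x x<y y<z δ
              (free (inj₁ (wx , wx≢ w<x x<y y<z δ))) (free (inj₁ (xy , xy≢ w<x x<y y<z δ)))
              (free (inj₁ (yz , yz≢ w<x x<y y<z δ))) (free (inj₁ (wz , wz≢ w<x x<y y<z δ))) ab×e)
      ... | no ¬ab×e = inj₁ (maximal T 1≤a a<b b≤N free′ ,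
              λ { refl → free (inj₂ refl) (diagonals-cross w<x x<y y<z δ) })
        where
        free′ : ∀ {c d} → Edge T c d → ¬ Crosses a b c d
        free′ {c} {d} cd with (c , d) ≟ₑ e
        ... | yes refl = ¬ab×e
        ... | no cd≢e  = free (inj₁ (cd , cd≢e))

    replaces⇒Flip : ∀ {T′} → e ∈ₑ T → Replaces T e f T′ → Flip T T′
    replaces⇒Flip {T′} = go {T′} δ
      where
      go : ∀ {T′ e f} → Diagonals w x y z e f → e ∈ₑ T → Replaces T e f T′ → Flip T T′
      go wy→xz e∈T r = w , x , y , z , (wx , xy , yz , wz) , inj₁ (e∈T , r)
      go xz→wy e∈T r = w , x , y , z , (wx , xy , yz , wz) , inj₂ (e∈T , r)

    flip-Flip : e ∈ₑ T → Flip T flip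
    flip-Flip e∈T = replaces⇒Flip {flip} e∈T λ _ _ → mk⇔ id id

    -- Maximality makes the inclusion of the remaining edges sufficient.
    ⊑⇒Flip : ∀ T′ → e ∈ₑ T → f ∈ₑ T′ →
      (∀ {a b} → Edge T a b → (a , b) ≢ e → Edge T′ a b) → Flip T T′
    ⊑⇒Flip T′ e∈T f∈T′ keeps = replaces⇒Flip {T′} e∈T λ _ _ → mk⇔ (⊑⇒⊒ flip T′ sub) sub
      where
      sub : flip ⊑ T′
      sub (inj₁ (ab , ab≢e)) = keeps ab ab≢e
      sub (inj₂ refl)        = f∈T′

Flip-cases : {T T′ : Triangulation N} → Flip T T′ →
  ∃ λ w → ∃ λ x → ∃ λ y → ∃ λ z → ∃ λ e → ∃ λ f →
    Quadrilateral T w x y z × Diagonals w x y z e f × e ∈ₑ T × Replaces T e f T′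
Flip-cases (w , x , y , z , (wx , xy , yz , wz) , inj₁ (e∈T , r)) =
  w , x , y , z , _ , _ , quad wx xy yz wz , wy→xz , e∈T , r
Flip-cases (w , x , y , z , (wx , xy , yz , wz) , inj₂ (e∈T , r)) =
  w , x , y , z , _ , _ , quad wx xy yz wz , xz→wy , e∈T , r

-- The sides survive the flip, so the same quadrilateral with its diagonals interchanged undoes it.
Flip-sym : (T T′ : Triangulation N) → Flip T T′ → Flip T′ T
Flip-sym T T′ fl with Flip-cases {T = T} {T′} fl
... | w , x , y , z , e , f , Q , δ , e∈T , r =
  ⊑⇒Flip T′ Q′ (opposite δ) T (from (r _ _) (inj₂ refl)) e∈T keeps
  where
  open Quadrilateral Q
  Q′ : Quadrilateral T′ w x y z
  Q′ = quad (from (r _ _) (inj₁ (wx , wx≢ w<x x<y y<z δ))) (from (r _ _) (inj₁ (xy , xy≢ w<x x<y y<z δ)))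
            (from (r _ _) (inj₁ (yz , yz≢ w<x x<y y<z δ))) (from (r _ _) (inj₁ (wz , wz≢ w<x x<y y<z δ)))
  keeps : ∀ {a b} → Edge T′ a b → (a , b) ≢ f → Edge T a b
  keeps ab ab≢f with to (r _ _) ab
  ... | inj₁ (ab∈T , _) = ab∈T
  ... | inj₂ ab≡f       = contradiction ab≡f ab≢f

Flip-respˡ-≈ : (T T′ T″ : Triangulation N) → T ≈ T′ → Flip T T″ → Flip T′ T″
Flip-respˡ-≈ T T′ T″ T≈T′ fl with Flip-cases {T = T} {T″} fl
... | w , x , y , z , e , f , quad wx xy yz wz , δ , e∈T , r =
  ⊑⇒Flip T′ (quad (to (T≈T′ _ _) wx) (to (T≈T′ _ _) xy) (to (T≈T′ _ _) yz) (to (T≈T′ _ _) wz)) δ T″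
    (to (T≈T′ _ _) e∈T) (from (r _ _) (inj₂ refl))
    λ ab ab≢e → from (r _ _) (inj₁ (from (T≈T′ _ _) ab , ab≢e))

Flips-respˡ-≈ : ∀ {m} {T T′ T″ : Triangulation N} → T ≈ T′ → Flips m T T″ → Flips m T′ T″
Flips-respˡ-≈ T≈T′ (done T≈T″) = done λ a b →
  mk⇔ (to (T≈T″ a b) ∘ from (T≈T′ a b)) (to (T≈T′ a b) ∘ from (T≈T″ a b))
Flips-respˡ-≈ {T = T} {T′} T≈T′ (step {T′ = T₁} fl fls) = step (Flip-respˡ-≈ T T′ T₁ T≈T′ fl) fls

-- Reversal with an accumulator, as for lists; `Flips-respˡ-≈` absorbs the `≈` that closes the first
-- path.
Flips-reverseOnto : ∀ {m l} {T T′ T″ : Triangulation N} → Flips m T T′ → Flips l T T″ → Flips (m + l) T′ T″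
Flips-reverseOnto (done T≈T′) fls′ = Flips-respˡ-≈ T≈T′ fls′
Flips-reverseOnto {m = suc m} {l} {T} {T′} {T″} (step {T′ = T₁} fl fls) fls′ =
  subst (λ k → Flips k T′ T″) (+-suc m l) (Flips-reverseOnto fls (step (Flip-sym T T₁ fl) fls′))

Flips-sym : ∀ {m} {T T′ : Triangulation N} → Flips m T T′ → Flips m T′ T
Flips-sym {m = m} {T} {T′} fls =
  subst (λ k → Flips k T′ T) (+-identityʳ m) (Flips-reverseOnto fls (done λ _ _ → mk⇔ id id))

FlipDistance-sym : ∀ {m} {T T′ : Triangulation N} → FlipDistance T T′ m → FlipDistance T′ T m
FlipDistance-sym (fls , least) = Flips-sym fls , least ∘ Flips-sym

-- Lower bound by counting new edges.

length-removal : (f : ℕ × ℕ) (es : List (ℕ × ℕ)) → Unique es →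
  length es ≤ suc (length (filter (λ e → ¬? (e ≟ₑ f)) es))
length-removal f [] _ = z≤n
length-removal f (e ∷ es) (e∉es ∷ es!) with e ≟ₑ f
... | yes refl = s≤s (≤-reflexive (cong length (sym (filter-all (λ e → ¬? (e ≟ₑ f)) (All.map ≢-sym e∉es)))))
... | no  _    = s≤s (length-removal f es es!)

-- Induction along the path. The first flip inserts only `f`, so the list without `f` is still
-- absent from the next triangulation; having no repetitions, it has lost at most one entry.
new-edges-≤ : ∀ {m} {T T′ : Triangulation N} → Flips m T T′ → (es : List (ℕ × ℕ)) → Unique es →
  All (_∈ₑ T′) es → All (λ e → ¬ e ∈ₑ T) es → length es ≤ m
new-edges-≤ _ [] _ _ _ = z≤n
new-edges-≤ (done T≈T′) (e ∷ _) _ (e∈T′ ∷ _) (e∉T ∷ _) = contradiction (from (T≈T′ _ _) e∈T′) e∉T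
new-edges-≤ {N} {T = T} {T″} (step {T′ = T′} fl fls) es es! es⊆T″ es∉T
  with Flip-cases {T = T} {T′} fl
... | _ , _ , _ , _ , e , f , _ , _ , _ , r = ≤-trans (length-removal f es es!)
  (s≤s (new-edges-≤ fls (filter f? es) (Unique.filter⁺ f? es!) (All.filter⁺ f? es⊆T″)
    (All.zipWith new (All.all-filter f? es , All.filter⁺ f? es∉T))))
  where
  f? : ∀ g → Dec (g ≢ f)
  f? g = ¬? (g ≟ₑ f)
  new : ∀ {g} → g ≢ f × ¬ g ∈ₑ T → ¬ g ∈ₑ T′
  new (g≢f , g∉T) g∈T′ with to (r _ _) g∈T′
  ... | inj₁ (g∈T , _) = g∉T g∈T
  ... | inj₂ g≡f       = g≢f g≡f

-- The outdegrees determine the triangulation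

module _ {P Q : Pred ℕ 0ℓ} (P? : Decidable₁ P) (Q? : Decidable₁ Q) (P⊆Q : ∀ {b} → P b → Q b) where

  length-filter-⊆ : ∀ xs → length (filter P? xs) ≤ length (filter Q? xs)
  length-filter-⊆ [] = z≤n
  length-filter-⊆ (x ∷ xs) with P? x | Q? x
  ... | yes _ | yes _ = s≤s (length-filter-⊆ xs)
  ... | yes p | no ¬q = contradiction (P⊆Q p) ¬q
  ... | no _  | yes _ = m≤n⇒m≤1+n (length-filter-⊆ xs)
  ... | no _  | no _  = length-filter-⊆ xs

  length-filter-⊂ : ∀ {x} xs → x ∈ xs → Q x → ¬ P x → length (filter P? xs) < length (filter Q? xs)
  length-filter-⊂ {x} (_ ∷ xs) (here refl) q ¬p
    rewrite filter-accept Q? {x} {xs} q | filter-reject P? {x} {xs} ¬p = s≤s (length-filter-⊆ xs)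
  length-filter-⊂ (x ∷ xs) (there x∈xs) q ¬p with P? x | Q? x
  ... | yes _ | yes _  = s≤s (length-filter-⊂ xs x∈xs q ¬p)
  ... | yes p | no ¬q′ = contradiction (P⊆Q p) ¬q′
  ... | no _  | yes _  = m≤n⇒m≤1+n (length-filter-⊂ xs x∈xs q ¬p)
  ... | no _  | no _   = length-filter-⊂ xs x∈xs q ¬p

∈-labels : ∀ {a} → 1 ≤ a → a ≤ N → a ∈ labels N
∈-labels {a = suc a} _ a<N = ∈-map⁺ suc (∈-upTo⁺ a<N)

map-≡⇒≗ : {f g : ℕ → ℕ} (xs : List ℕ) → map f xs ≡ map g xs → ∀ {x} → x ∈ xs → f x ≡ g x
map-≡⇒≗ (_ ∷ _)  eq (here refl)  = proj₁ (∷-injective eq)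
map-≡⇒≗ (_ ∷ xs) eq (there x∈xs) = map-≡⇒≗ xs (proj₂ (∷-injective eq)) x∈xs

-- A chord e f over c with e < a would cross ab, so only chords issuing from
-- vertices beyond a can separate a from c.
visible⇒Edge : (T : Triangulation N) → ∀ {a b c} → Edge T a b → a < c → c < b →
  (∀ {e f} → Edge T e f → a < e → e < c → ¬ c < f) → Edge T a c
visible⇒Edge T {a} {b} {c} ab a<c c<b visible =
  let 1≤a , _ , b≤N = ordered T ab in
  maximal T 1≤a a<c (<⇒≤ (<-≤-trans c<b b≤N)) λ
    { ef (inj₁ (a<e , e<c , c<f)) → visible ef a<e e<c c<f
    ; ef (inj₂ (e<a , a<f , f<c)) → noncrossing T ef ab (inj₁ (e<a , a<f , <-trans f<c c<b)) }

outDiagonal? : (T : Triangulation N) (a b : ℕ) → Dec (Edge T a b × b ≢ suc a)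
outDiagonal? T a b = edge? T a b ×-dec ¬? (b ≟ suc a)

AgreeBeyond : ℕ → Triangulation N → Triangulation N → Set
AgreeBeyond a T T′ = ∀ {e f} → a < e → Edge T e f ⇔ Edge T′ e f

-- The out-neighbours of a form an initial segment of the vertices visible from
-- a, and two initial segments of the same size coincide.
equal-outdegree⇒⊑ : (T T′ : Triangulation N) → ∀ {a} → AgreeBeyond a T T′ →
  diagonalOutdegree T a ≡ diagonalOutdegree T′ a → ∀ {b} → b ≢ suc a → Edge T a b → Edge T′ a b
equal-outdegree⇒⊑ T T′ {a} agree deg≡ {b} b≢1+a ab with edge? T′ a b
... | yes ab′ = ab′
... | no ¬ab′ = contradiction (sym deg≡) (<⇒≢ (length-filter-⊂
      (outDiagonal? T′ a) (outDiagonal? T a)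
      (λ { (ac , c≢1+a) → shorter ac , c≢1+a })
      _ (∈-labels (≤-trans (proj₁ (ordered T ab)) (<⇒≤ (proj₁ (proj₂ (ordered T ab))))) (proj₂ (proj₂ (ordered T ab))))
      (ab , b≢1+a) (λ { (ab′ , _) → ¬ab′ ab′ })))
  where
  shorter : ∀ {c} → Edge T′ a c → Edge T a c
  shorter {c} ac with <-cmp c b
  ... | tri≈ _ refl _ = ab
  ... | tri< c<b _ _ = visible⇒Edge T ab (proj₁ (proj₂ (ordered T′ ac))) c<b λ ef a<e e<c c<f →
          noncrossing T′ ac (to (agree a<e) ef) (inj₁ (a<e , e<c , c<f))
  -- A longer chord from `a` to `c` in `T′` would leave `b` visible from `a`, forcing the chord that
  -- `T′` lacks.
  ... | tri> _ _ b<c = contradiction (visible⇒Edge T′ ac (proj₁ (proj₂ (ordered T ab))) b<c λ ef a<e e<b b<f →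
          noncrossing T ab (from (agree a<e) ef) (inj₁ (a<e , e<b , b<f))) ¬ab′

-- Descending induction over the vertices: once the chords issuing from later vertices agree, the
-- outdegree at `a` fixes those issuing from `a`. The fuel `k` bounds the distance from `a` to
-- `2 + n`.
D-injective : (T T′ : Triangulation (2 + n)) → D n T ≡ D n T′ → T ≈ T′
D-injective {n} T T′ D≡ a b = agree (2 + n) a (m≤n+m (2 + n) a) b
  where
  agree : ∀ k a → 2 + n ≤ a + k → ∀ b → Edge T a b ⇔ Edge T′ a b
  agree zero a N≤a b = mk⇔ (λ ab → contradiction (a<N (ordered T ab)) (≤⇒≯ N≤a′))
                           (λ ab → contradiction (a<N (ordered T′ ab)) (≤⇒≯ N≤a′))
    where
    N≤a′ = subst (2 + n ≤_) (+-identityʳ a) N≤a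
    a<N : ∀ {b} → 1 ≤ a × a < b × b ≤ 2 + n → a < 2 + n
    a<N (_ , a<b , b≤N) = <-≤-trans a<b b≤N
  agree (suc k) a N≤a+1+k b = mk⇔ (half T T′ beyond id) (half T′ T
    (λ a<e → mk⇔ (from (beyond a<e)) (to (beyond a<e))) sym)
    where
    beyond : AgreeBeyond a T T′
    beyond {e} {f} a<e = agree k e
      (≤-trans (≤-trans N≤a+1+k (≤-reflexive (+-suc a k))) (+-monoˡ-≤ k a<e)) f
    half : (S S′ : Triangulation (2 + n)) → AgreeBeyond a S S′ →
      (diagonalOutdegree T a ≡ diagonalOutdegree T′ a → diagonalOutdegree S a ≡ diagonalOutdegree S′ a) →
      Edge S a b → Edge S′ a b
    half S S′ ag deg ab with b ≟ suc a | ordered S ab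
    ... | yes refl | 1≤a , _ , a<N = boundary S′ 1≤a a<N
    ... | no b≢1+a | 1≤a , a<b , b≤N = equal-outdegree⇒⊑ S S′ ag
      -- `D` stops at label `n`. This covers `a`, since a chord that is not a side has
      -- `2 + a ≤ b ≤ 2 + n`.
      (deg (map-≡⇒≗ (labels n) D≡ (∈-labels 1≤a
        (≤-pred (≤-pred (≤-trans (≤∧≢⇒< a<b (≢-sym b≢1+a)) b≤N)))))) b≢1+a ab

-- The triangulations of the generators

-- With p = 3 + q: vertex 2 is joined to 3, …, p and vertex 1 to p, …, n + 2.
FanEdge : (n q a b : ℕ) → Set
FanEdge n q a b = (1 ≤ a × a < b × b ≤ 2 + n) ×
  (b ≡ suc a ⊎ (a ≡ 2 × b ≤ 3 + q) ⊎ (a ≡ 1 × 3 + q ≤ b))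

pattern side o    = o , inj₁ refl
pattern from₂ o r = o , inj₂ (inj₁ (refl , r))
pattern from₁ o r = o , inj₂ (inj₂ (refl , r))

fanEdge? : ∀ n q a b → Dec (FanEdge n q a b)
fanEdge? n q a b = (1 ≤? a ×-dec a <? b ×-dec b ≤? 2 + n) ×-dec
  (b ≟ suc a ⊎-dec (a ≟ 2 ×-dec b ≤? 3 + q) ⊎-dec (a ≟ 1 ×-dec 3 + q ≤? b))

module _ {n q : ℕ} where

  -- Only a spoke from 1 followed by a spoke from 2 could interleave, but the former ends at or
  -- after p and the latter at or before p.
  fan-interleaved : ∀ {a b c d} → FanEdge n q a b → FanEdge n q c d → ¬ (a < c × c < b × b < d)
  fan-interleaved (side _)    _           (a<c , c<b , _)   = <⇒≱ c<b a<c
  fan-interleaved (from₂ _ _) (side _)    (_ , c<b , b<1+c) = <⇒≱ b<1+c c<b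
  fan-interleaved (from₁ _ _) (side _)    (_ , c<b , b<1+c) = <⇒≱ b<1+c c<b
  fan-interleaved (from₂ _ _) (from₂ _ _) (2<2 , _)         = <-irrefl refl 2<2
  fan-interleaved (from₂ _ _) (from₁ _ _) (s≤s () , _)
  fan-interleaved (from₁ _ p≤b) (from₂ _ d≤p) (_ , _ , b<d) = <⇒≱ b<d (≤-trans d≤p p≤b)
  fan-interleaved (from₁ _ _) (from₁ _ _) (1<1 , _)         = <-irrefl refl 1<1

  fan-noncrossing : ∀ {a b c d} → FanEdge n q a b → FanEdge n q c d → ¬ Crosses a b c d
  fan-noncrossing ab cd (inj₁ a<c<b<d) = fan-interleaved ab cd a<c<b<d
  fan-noncrossing ab cd (inj₂ c<a<d<b) = fan-interleaved cd ab c<a<d<b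

  module _ (q<n : q < n) where

    join₁ : ∀ {b} → 3 + q ≤ b → b ≤ 2 + n → FanEdge n q 1 b
    join₁ p≤b b≤N = from₁ (z<s , ≤-trans (s≤s (s≤s z≤n)) p≤b , b≤N) p≤b

    join₂ : ∀ {b} → 2 < b → b ≤ 3 + q → FanEdge n q 2 b
    join₂ 2<b b≤p = from₂ (z<s , 2<b , ≤-trans b≤p (s≤s (s≤s q<n))) b≤p

    -- Every other chord is crossed by a spoke: from 1 ending before p, by the spoke from 2 to p;
    -- from 2 ending after p, by the spoke from 1 to p; starting later, by a spoke to the vertex
    -- right after its lower end.
    fan-maximal : ∀ {a b} → 1 ≤ a → a < b → b ≤ 2 + n →
      (∀ {c d} → FanEdge n q c d → ¬ Crosses a b c d) → FanEdge n q a b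
    fan-maximal {a} {b} 1≤a a<b b≤N free with b ≟ suc a
    ... | yes b≡1+a = (1≤a , a<b , b≤N) , inj₁ b≡1+a
    fan-maximal {1} {b} 1≤a a<b b≤N free | no b≢2 with 3 + q ≤? b
    ... | yes p≤b = join₁ p≤b b≤N
    ... | no  p≰b = contradiction (inj₁ (≤-refl , ≤∧≢⇒< a<b (≢-sym b≢2) , ≰⇒> p≰b))
                      (free (join₂ (s≤s (s≤s (s≤s z≤n))) ≤-refl))
    fan-maximal {2} {b} 1≤a a<b b≤N free | no b≢3 with b ≤? 3 + q
    ... | yes b≤p = join₂ a<b b≤p
    ... | no  b≰p = contradiction (inj₂ (≤-refl , s≤s (s≤s (s≤s z≤n)) , ≰⇒> b≰p))
                      (free (join₁ ≤-refl (s≤s (s≤s q<n))))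
    fan-maximal {suc (suc (suc a))} {b} 1≤a a<b b≤N free | no b≢1+a with 4 + a ≤? 3 + q
    ... | yes c≤p = contradiction (inj₂ (s≤s (s≤s (s≤s z≤n)) , ≤-refl , ≤∧≢⇒< a<b (≢-sym b≢1+a)))
                      (free (join₂ (s≤s (s≤s (s≤s z≤n))) c≤p))
    ... | no  c≰p = contradiction (inj₂ (s≤s (s≤s z≤n) , ≤-refl , ≤∧≢⇒< a<b (≢-sym b≢1+a)))
                      (free (join₁ (<⇒≤ (≰⇒> c≰p)) (≤-trans a<b b≤N)))

    fan : Triangulation (2 + n)
    fan = record
      { graph       = record { Edge = FanEdge n q ; edge? = fanEdge? n q }
      ; ordered     = proj₁
      ; noncrossing = fan-noncrossing
      ; maximal     = fan-maximal
      }

fan-step : ∀ {n q} (h : suc q < n) (h′ : q < n) → Flip (fan h) (fan h′)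
fan-step {n} {q} h h′ = ⊑⇒Flip (fan h)
  -- The quadrilateral is 1, 2, `3 + q`, `4 + q`; the chord from 2 to `4 + q` gives way to the one
  -- from 1 to `3 + q`.
  (quad (boundary (fan h) ≤-refl (s≤s (s≤s z≤n))) (join₂ h (s≤s (s≤s (s≤s z≤n))) (n≤1+n _))
        (boundary (fan h) z<s (s≤s (s≤s h))) (join₁ h ≤-refl (s≤s (s≤s h))))
  xz→wy (fan h′) (join₂ h (s≤s (s≤s (s≤s z≤n))) ≤-refl) (join₁ h′ ≤-refl (s≤s (s≤s h′)))
  λ { (side o) _        → side o
    ; (from₂ o b≤p) b≢p → from₂ o (≤-pred (≤∧≢⇒< b≤p λ { refl → b≢p refl }))
    ; (from₁ o p≤b) _   → from₁ o (<⇒≤ p≤b) }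

-- The remaining path is given for every proof of `q < n`, because a fan carries such a proof and
-- the steps produce a particular one.
fans : ∀ {n q l} {T : Triangulation (2 + n)} k → (∀ h → Flips l (fan {n} {q} h) T) →
  ∀ h → Flips (k + l) (fan {n} {k + q} h) T
fans zero rest h = rest h
fans {n} {q} (suc k) rest h = step (fan-step {n} {k + q} h (<⇒≤ h)) (fans k rest (<⇒≤ h))

module _ {n s : ℕ} (h : 2 + s < n) where

  -- Here p = `5 + s`. Exchanging the spoke from 2 to `4 + s` for the other diagonal cuts off the
  -- ear `4 + s`.
  2-quad : Quadrilateral (fan h) 2 (3 + s) (4 + s) (5 + s)
  2-quad = quad (join₂ h (s≤s (s≤s (s≤s z≤n))) (≤-trans (n≤1+n _) (n≤1+n _)))
    (boundary (fan h) z<s (<⇒≤ (s≤s (s≤s h)))) (boundary (fan h) z<s (s≤s (s≤s h)))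
    (join₂ h (s≤s (s≤s (s≤s z≤n))) ≤-refl)

  2-diagonal : FanEdge n (2 + s) 2 (4 + s)
  2-diagonal = join₂ h (s≤s (s≤s (s≤s z≤n))) (n≤1+n _)

-- The triangulation of u_i for s = n - 1 - i.
generator : ∀ n s → suc s < n → Triangulation (2 + n)
-- The type of `h` gives `q = 1`, so p = 4.
generator n zero    h = fan h
generator n (suc s) h = flip (fan h) (2-quad h) wy→xz

generator⇒fan : ∀ {n s} (h : 2 + s < n) h′ → Flip (generator n (suc s) h) (fan {n} {2 + s} h′)
generator⇒fan h h′ with ≤-irrelevant h h′
... | refl = Flip-sym (fan h) (generator _ _ h) (flip-Flip (fan h) (2-quad h) wy→xz (2-diagonal h))

fan⇒generator : ∀ {n s} (h : 2 + s < n) h′ → Flip (fan {n} {2 + s} h′) (generator n (suc s) h)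
fan⇒generator h h′ = Flip-sym (generator _ _ h) (fan h′) (generator⇒fan h h′)

module _ {n s : ℕ} (h : 2 + s < n) where

  private
    s<n : s < n
    s<n = <⇒≤ (<⇒≤ h)

    1-quad : Quadrilateral (fan s<n) 1 (3 + s) (4 + s) (5 + s)
    1-quad = quad (join₁ s<n ≤-refl (s≤s (s≤s s<n)))
      (boundary (fan s<n) z<s (<⇒≤ (s≤s (s≤s h)))) (boundary (fan s<n) z<s (s≤s (s≤s h)))
      (join₁ s<n (≤-trans (n≤1+n _) (n≤1+n _)) (s≤s (s≤s h)))

    1-diagonal : FanEdge n s 1 (4 + s)
    1-diagonal = join₁ s<n (n≤1+n _) (<⇒≤ (s≤s (s≤s h)))

    -- The bypass: it has the ear chord of the generator but, like the fan with p = `3 + s`, no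
    -- spoke from 2 beyond `3 + s`.
    middle : Triangulation (2 + n)
    middle = flip (fan s<n) 1-quad wy→xz

    generator⇒middle : Flip (generator n (suc s) h) middle
    generator⇒middle = ⊑⇒Flip (generator n (suc s) h)
      -- In 1, 2, `3 + s`, `5 + s`, the last spoke of 2 gives way to the spoke from 1 to `3 + s`.
      (quad (boundary (generator n (suc s) h) ≤-refl (s≤s (s≤s z≤n)))
            (inj₁ (Quadrilateral.wx (2-quad h) , λ ())) (inj₂ refl)
            (inj₁ (join₁ h ≤-refl (s≤s (s≤s h)) , λ ())))
      xz→wy middle (inj₁ (Quadrilateral.wz (2-quad h) , λ ()))
      (inj₁ (Quadrilateral.wx 1-quad , λ ()))
      λ { (inj₂ refl) _ → inj₂ refl
        ; (inj₁ (side o , _)) _ → inj₁ (side o , λ ())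
        -- A spoke of 2 other than the flipped one to `5 + s` and the missing one to `4 + s` ends by
        -- `3 + s`.
        ; (inj₁ (from₂ o b≤5+s , b≢4+s)) b≢5+s → inj₁
            ( from₂ o (≤-pred (≤∧≢⇒< (≤-pred (≤∧≢⇒< b≤5+s λ { refl → b≢5+s refl })) λ { refl → b≢4+s refl }))
            , λ ())
        ; (inj₁ (from₁ o 5+s≤b , _)) _ → inj₁
            (from₁ o (≤-trans (≤-trans (n≤1+n _) (n≤1+n _)) 5+s≤b) , λ { refl → <-irrefl refl 5+s≤b }) }

  -- By way of the fans with p = `5 + s` and p = `4 + s` the same fan would cost three flips.
  generator⇒²fan : ∀ {l} {T : Triangulation (2 + n)} → (∀ h′ → Flips l (fan {n} {s} h′) T) →
    Flips (2 + l) (generator n (suc s) h) T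
  generator⇒²fan rest = step {T′ = middle} generator⇒middle (step {T′ = fan s<n}
    (Flip-sym (fan s<n) middle (flip-Flip (fan s<n) 1-quad wy→xz 1-diagonal)) (rest s<n))

-- Flip distances between the generators

module _ {n : ℕ} where

  generator-spoke₁ : ∀ s (h : suc s < n) {b} → 4 + s ≤ b → b ≤ 2 + n → Edge (generator n s h) 1 b
  generator-spoke₁ zero    h 4≤b b≤N = join₁ h 4≤b b≤N
  generator-spoke₁ (suc s) h p≤b b≤N = inj₁ (join₁ h p≤b b≤N , λ ())

  generator-spoke₁⁻ : ∀ s (h : suc s < n) {b} → Edge (generator n s h) 1 b → b ≡ 2 ⊎ 4 + s ≤ b
  generator-spoke₁⁻ zero    h (side _)              = inj₁ refl
  generator-spoke₁⁻ zero    h (from₁ _ 4≤b)         = inj₂ 4≤b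
  generator-spoke₁⁻ (suc s) h (inj₁ (side _ , _))   = inj₁ refl
  generator-spoke₁⁻ (suc s) h (inj₁ (from₁ _ p≤b , _)) = inj₂ p≤b

  generator-spoke₂ : ∀ s (h : suc s < n) → Edge (generator n s h) 2 (4 + s)
  generator-spoke₂ zero    h = join₂ h (s≤s (s≤s (s≤s z≤n))) ≤-refl
  generator-spoke₂ (suc s) h = inj₁ (Quadrilateral.wz (2-quad h) , λ ())

  generator-ear : ∀ s (h : suc s < n) → Edge (generator n s h) (2 + s) (4 + s)
  generator-ear zero    h = join₂ h (s≤s (s≤s (s≤s z≤n))) ≤-refl
  generator-ear (suc s) h = inj₂ refl

  -- Apart from sides, only the ear chord can start above label 2, and it starts at `2 + s`.
  generator-chord₃⁻ : ∀ s (h : suc s < n) {a b} → Edge (generator n s h) (3 + a) b →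
    b ≡ 4 + a ⊎ 1 + a ≡ s × b ≡ 4 + s
  generator-chord₃⁻ zero    h (side _)            = inj₁ refl
  generator-chord₃⁻ zero    h (_ , inj₂ (inj₁ (() , _)))
  generator-chord₃⁻ zero    h (_ , inj₂ (inj₂ (() , _)))
  generator-chord₃⁻ (suc s) h (inj₁ (side _ , _)) = inj₁ refl
  generator-chord₃⁻ (suc s) h (inj₁ ((_ , inj₂ (inj₁ (() , _))) , _))
  generator-chord₃⁻ (suc s) h (inj₁ ((_ , inj₂ (inj₂ (() , _))) , _))
  generator-chord₃⁻ (suc s) h (inj₂ refl)         = inj₂ (refl , refl)

  module _ {k s : ℕ} (h : suc (k + s) < n) (h′ : suc s < n) where

    -- The spokes of vertex 1 begin at `4 + (k + s)` in the source and at `4 + s` in the target;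
    -- these are the `k` in between.
    spokes : List (ℕ × ℕ)
    spokes = applyUpTo (λ j → 1 , 4 + s + j) k

    spokes-unique : Unique spokes
    spokes-unique = Unique.applyUpTo⁺₁ _ k λ i<j _ eq → <⇒≢ i<j (+-cancelˡ-≡ s _ _
      (suc-injective (suc-injective (suc-injective (suc-injective (cong proj₂ eq))))))

    spokes-new : All (_∈ₑ generator n s h′) spokes
    spokes-new = All.applyUpTo⁺₁ _ k λ {j} j<k → generator-spoke₁ s h′ (m≤m+n (4 + s) j)
      (s≤s (s≤s (<⇒≤ (≤-<-trans (s≤s (≤-trans (≤-reflexive (sym (+-suc s j)))
        (≤-trans (+-monoʳ-≤ s j<k) (≤-reflexive (+-comm s k))))) h))))

    spokes-absent : All (λ e → ¬ e ∈ₑ generator n (k + s) h) spokes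
    spokes-absent = All.applyUpTo⁺₁ _ k λ {j} j<k e∈ → absent j<k (generator-spoke₁⁻ (k + s) h e∈)
      where
      absent : ∀ {j} → j < k → ¬ (4 + s + j ≡ 2 ⊎ 4 + (k + s) ≤ 4 + s + j)
      absent {j} j<k (inj₂ le) = <⇒≱ j<k (+-cancelʳ-≤ s k j
        (≤-trans (+-cancelˡ-≤ 4 _ _ le) (≤-reflexive (+-comm s j))))

    spokes-≤ : ∀ {m} → Flips m (generator n (k + s) h) (generator n s h′) → k ≤ m
    spokes-≤ fls = ≤-trans (≤-reflexive (sym (length-applyUpTo _ k)))
      (new-edges-≤ fls spokes spokes-unique spokes-new spokes-absent)

  module _ {k s : ℕ} (h : suc (k + suc s) < n) (h′ : 2 + s < n) (0<k : 0 < k) where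

    ear-absent : ¬ Edge (generator n (k + suc s) h) (3 + s) (5 + s)
    ear-absent e∈ with generator-chord₃⁻ (k + suc s) h e∈
    ... | inj₂ (1+s≡k+1+s , _) = <⇒≢ (+-monoˡ-< (suc s) 0<k) 1+s≡k+1+s

    -- The ear chord of the target is no spoke here, and it is new since the source has its ear
    -- elsewhere.
    ear+spokes-≤ : ∀ {m} → Flips m (generator n (k + suc s) h) (generator n (suc s) h′) → suc k ≤ m
    ear+spokes-≤ fls = ≤-trans (≤-reflexive (cong suc (sym (length-applyUpTo _ k))))
      (new-edges-≤ fls ((3 + s , 5 + s) ∷ spokes h h′)
        (All.applyUpTo⁺₂ _ k (λ _ ()) ∷ spokes-unique h h′)
        (generator-ear (suc s) h′ ∷ spokes-new h h′)
        (ear-absent ∷ spokes-absent h h′))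

  spoke₂-absent : ∀ s (h : 2 + s < n) → ¬ Edge (generator n (suc s) h) 2 (4 + s)
  spoke₂-absent s h (inj₁ (_ , ≢diagonal)) = ≢diagonal refl

  -- Besides the ear chord and one spoke from 1, the spoke from 2 to `5 + s` is new, because `5 + s`
  -- is the ear of the source. This happens only for neighbouring generators and raises the distance
  -- to 3.
  distance₁ : ∀ s (h : 3 + s < n) (h′ : 2 + s < n) →
    FlipDistance (generator n (2 + s) h) (generator n (suc s) h′) 3
  distance₁ s h h′ =
      step {T′ = fan h} (generator⇒fan h h)
      (step {T′ = fan h′} (fan-step h h′)
      (step {T′ = generator n (suc s) h′} (fan⇒generator h′ h′)
      (done λ _ _ → mk⇔ id id)))
    , λ fls → new-edges-≤ fls ((3 + s , 5 + s) ∷ (2 , 5 + s) ∷ spokes {1} h h′)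
        (((λ ()) ∷ (λ ()) ∷ []) ∷ ((λ ()) ∷ []) ∷ spokes-unique {1} h h′)
        (generator-ear (suc s) h′ ∷ generator-spoke₂ (suc s) h′ ∷ spokes-new {1} h h′)
        (ear-absent {1} h h′ z<s ∷ spoke₂-absent (suc s) h ∷ spokes-absent {1} h h′)

  -- The target is itself the fan with p = 4, and its ear chord is the spoke from 2 to 4, so one
  -- flip and one new edge drop out.
  distance₁-last : ∀ (h : 2 < n) (h′ : 1 < n) → FlipDistance (generator n 1 h) (generator n 0 h′) 2
  distance₁-last h h′ =
      step {T′ = fan h} (generator⇒fan h h)
      (step {T′ = fan h′} (fan-step h h′)
      (done λ _ _ → mk⇔ id id))
    , λ fls → new-edges-≤ fls ((2 , 4) ∷ spokes {1} {0} h h′)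
        (((λ ()) ∷ []) ∷ spokes-unique {1} {0} h h′)
        (generator-spoke₂ 0 h′ ∷ spokes-new {1} h h′)
        (spoke₂-absent 0 h ∷ spokes-absent {1} h h′)

  generator⇒fans : ∀ k s (h : suc (2 + k + s) < n) {l} {T : Triangulation (2 + n)} →
    (∀ h′ → Flips l (fan {n} {suc s} h′) T) → Flips (2 + (k + l)) (generator n (2 + k + s) h) T
  generator⇒fans k s h {l} {T} rest = generator⇒²fan h
    (subst (λ q → ∀ (h′ : q < n) → Flips (k + l) (fan h′) T) (+-suc k s) (fans k rest))

  -- The indices differ by `2 + k`. The bypass takes 2 flips, the fan steps `k`, and a last flip
  -- creates the ear chord of the target.
  distance : ∀ k s (h : suc (2 + k + suc s) < n) (h′ : 2 + s < n) →
    FlipDistance (generator n (2 + k + suc s) h) (generator n (suc s) h′) (3 + k)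
  distance k s h h′ =
      subst (λ l → Flips (2 + l) (generator n (2 + k + suc s) h) (generator n (suc s) h′)) (+-comm k 1)
        (generator⇒fans k (suc s) h λ h″ → step {T′ = generator n (suc s) h′} (fan⇒generator h′ h″)
          (done λ _ _ → mk⇔ id id))
    , ear+spokes-≤ h h′ z<s

  -- The path ends at a fan, and the source already contains the spoke from 2 to 4, so only spokes
  -- from 1 are new.
  distance-last : ∀ k (h : suc (2 + k + 0) < n) (h′ : 1 < n) →
    FlipDistance (generator n (2 + k + 0) h) (generator n 0 h′) (2 + k)
  distance-last k h h′ =
      subst (λ l → Flips (2 + l) (generator n (2 + k + 0) h) (generator n 0 h′)) (+-identityʳ k)
        (generator⇒fans k 0 h λ _ → done λ _ _ → mk⇔ id id)
    , spokes-≤ h h′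

-- The outdegree sequences of the generators

-- The start moves with the recursion, so a tail is again a `span` and blocks can be peeled off.
span : (a k : ℕ) → List ℕ
span a zero    = []
span a (suc k) = suc a ∷ span (suc a) k

labels≡span : ∀ N → labels N ≡ span 0 N
labels≡span N = trans (map-applyUpTo id suc N) (shifted suc 0 N λ _ → refl)
  where
  shifted : ∀ (f : ℕ → ℕ) a k → (∀ j → f j ≡ suc (a + j)) → applyUpTo f k ≡ span a k
  shifted f a zero    f≗ = refl
  shifted f a (suc k) f≗ = cong₂ _∷_ (trans (f≗ 0) (cong suc (+-identityʳ a)))
    (shifted (f ∘ suc) (suc a) k λ j → trans (f≗ (suc j)) (cong suc (+-suc a j)))

-- The block lemmas peel off the labels a + 1, …, a + k = a′ from the front.

Throughout : Pred ℕ 0ℓ → ℕ → ℕ → Set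
Throughout P a a′ = ∀ {b} → a < b → b ≤ a′ → P b

module _ {P : Pred ℕ 0ℓ} {a k a′ : ℕ} (a+1+k≡a′ : a + suc k ≡ a′) (P! : Throughout P a a′) where

  throughout-head : P (suc a)
  throughout-head = P! ≤-refl (≤-trans (m≤m+n (suc a) k) (≤-reflexive (trans (sym (+-suc a k)) a+1+k≡a′)))

  throughout-tail : Throughout P (suc a) a′
  throughout-tail 1+a<b = P! (<⇒≤ 1+a<b)

  tail-end : suc a + k ≡ a′
  tail-end = trans (sym (+-suc a k)) a+1+k≡a′

module _ (f : ℕ → ℕ) where

  map-zeros : ∀ a k l {a′} → a + k ≡ a′ → Throughout (λ b → f b ≡ 0) a a′ →
    map f (span a (k + l)) ≡ replicate k 0 ++ map f (span a′ l)
  map-zeros a zero    l eq f≡0 rewrite trans (sym (+-identityʳ a)) eq = refl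
  map-zeros a (suc k) l eq f≡0 = cong₂ _∷_ (throughout-head eq f≡0)
    (map-zeros (suc a) k l (tail-end eq f≡0) (throughout-tail eq f≡0))

  runsFrom-ones : ∀ c a k l {a′} → a + k ≡ a′ → Throughout (λ b → 0 < f b) a a′ →
    runsFrom c (map f (span a (k + l))) ≡ runsFrom (c + k) (map f (span a′ l))
  runsFrom-ones c a zero    l eq f>0 rewrite trans (sym (+-identityʳ a)) eq | +-identityʳ c = refl
  runsFrom-ones c a (suc k) l {a′} eq f>0 with f (suc a) | throughout-head eq f>0
  ... | suc _ | _ = trans (runsFrom-ones (suc c) (suc a) k l (tail-end eq f>0) (throughout-tail eq f>0))
    (cong (λ m → runsFrom m (map f (span a′ l))) (sym (+-suc c k)))

  -- The first zero closes the run of length `c`, each further one an empty run.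
  runsFrom-zeros : ∀ c a k l {a′} → a + suc k ≡ a′ → Throughout (λ b → f b ≡ 0) a a′ →
    runsFrom c (map f (span a (suc k + l))) ≡ c ∷ replicate k 0 ++ runsFrom 0 (map f (span a′ l))
  runsFrom-zeros c a zero    l eq f≡0 rewrite throughout-head eq f≡0 | trans (+-comm 1 a) eq = refl
  runsFrom-zeros c a (suc k) l eq f≡0 rewrite throughout-head eq f≡0 =
    cong (c ∷_) (runsFrom-zeros 0 (suc a) k l (tail-end eq f≡0) (throughout-tail eq f≡0))

module _ {P : Pred ℕ 0ℓ} (P? : Decidable₁ P) where

  count-none : ∀ a k l {a′} → a + k ≡ a′ → Throughout (λ b → ¬ P b) a a′ →
    length (filter P? (span a (k + l))) ≡ length (filter P? (span a′ l))
  count-none a zero    l eq ¬p rewrite trans (sym (+-identityʳ a)) eq = refl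
  count-none a (suc k) l eq ¬p = trans
    (cong length (filter-reject P? (throughout-head eq ¬p)))
    (count-none (suc a) k l (tail-end eq ¬p) (throughout-tail eq ¬p))

  count-all : ∀ a k l {a′} → a + k ≡ a′ → Throughout P a a′ →
    length (filter P? (span a (k + l))) ≡ k + length (filter P? (span a′ l))
  count-all a zero    l eq p rewrite trans (sym (+-identityʳ a)) eq = refl
  count-all a (suc k) l eq p = trans
    (cong length (filter-accept P? (throughout-head eq p)))
    (cong suc (count-all (suc a) k l (tail-end eq p) (throughout-tail eq p)))

  count-interval : ∀ l k m {N} → N ≡ l + (k + (m + 0)) → (∀ {b} → b ≤ l → ¬ P b) → Throughout P l (l + k) →
    (∀ {b} → l + k < b → ¬ P b) → length (filter P? (labels N)) ≡ k
  count-interval l k m {N} refl below within above = begin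
    length (filter P? (labels N))              ≡⟨ cong (length ∘ filter P?) (labels≡span N) ⟩
    length (filter P? (span 0 N))              ≡⟨ count-none 0 l _ refl (λ _ → below) ⟩
    length (filter P? (span l (k + (m + 0))))  ≡⟨ count-all l k _ refl within ⟩
    k + length (filter P? (span (l + k) (m + 0)))
      ≡⟨ cong (k +_) (count-none (l + k) m 0 refl (λ l+k<b _ → above l+k<b)) ⟩
    k + 0                                      ≡⟨ +-identityʳ k ⟩
    k                                          ∎
    where open ≡-Reasoning

-- The outdegree sequence of the triangulation of u_i for i = r + 1 and
-- n = s + r + 2.
outdegrees : (s r : ℕ) → List ℕ
outdegrees zero    r = suc r ∷ 1 ∷ replicate r 0 ++ []
outdegrees (suc s) r = suc r ∷ suc s ∷ replicate s 0 ++ 1 ∷ replicate r 0 ++ []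

-- Outdegrees of the triangulations.

module _ (r : ℕ) where

  private
    -- Block lengths end in `+ 0` so that the last block, too, has the form `k + l`.
    shift : ∀ s → suc (s + r) ≡ s + suc (r + 0)
    shift s = trans (sym (+-suc s r)) (cong (λ m → s + suc m) (sym (+-identityʳ r)))

    deg : ∀ s → suc s < 2 + (s + r) → ℕ → ℕ
    deg s h = diagonalOutdegree (generator (2 + (s + r)) s h)

    deg₁ : ∀ s h → deg s h 1 ≡ suc r
    deg₁ s h = count-interval (outDiagonal? (generator _ s h) 1) (3 + s) (suc r) 0
      (cong (3 +_) (shift s))
      (λ { b≤3+s (e , b≢2) → below b≤3+s b≢2 (generator-spoke₁⁻ s h e) })
      (λ 3+s<b b≤N → generator-spoke₁ s h 3+s<b (≤-trans b≤N (≤-reflexive (cong (3 +_) (+-suc s r))))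
                   , λ { refl → contradiction 3+s<b λ { (s≤s (s≤s ())) } })
      (λ { N<b (e , _) → <⇒≱ N<b (≤-trans (proj₂ (proj₂ (ordered (generator _ s h) e)))
                                     (≤-reflexive (cong (3 +_) (sym (+-suc s r))))) })
      where
      below : ∀ {b} → b ≤ 3 + s → b ≢ 2 → ¬ (b ≡ 2 ⊎ 4 + s ≤ b)
      below b≤3+s b≢2 (inj₁ b≡2)   = b≢2 b≡2
      below b≤3+s b≢2 (inj₂ 4+s≤b) = <⇒≱ 4+s≤b b≤3+s

    deg-ear : ∀ s h → deg (suc s) h (3 + s) ≡ 1
    deg-ear s h = count-interval (outDiagonal? (generator _ (suc s) h) (3 + s)) (4 + s) 1 r (cong (4 +_) (shift s))
      (λ { b≤4+s (e , b≢) → <⇒≢ (s≤s b≤4+s) (ear e b≢) })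
      (λ 4+s<b b≤ → let b≡ = ≤-antisym (≤-trans b≤ (≤-reflexive (+-comm (4 + s) 1))) 4+s<b in
        subst (Edge (generator _ (suc s) h) (3 + s)) (sym b≡) (generator-ear (suc s) h)
        , λ b≡4+s → <⇒≢ 4+s<b (sym b≡4+s))
      (λ { 5+s<b (e , b≢) → <⇒≢ (≤-<-trans (≤-reflexive (+-comm 1 (4 + s))) 5+s<b) (sym (ear e b≢)) })
      where
      ear : ∀ {b} → Edge (generator _ (suc s) h) (3 + s) b → b ≢ 4 + s → b ≡ 5 + s
      ear e b≢ with generator-chord₃⁻ (suc s) h e
      ... | inj₁ b≡       = contradiction b≡ b≢
      ... | inj₂ (_ , b≡) = b≡

    deg₃ : ∀ s h a → suc a ≢ s → deg s h (3 + a) ≡ 0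
    deg₃ s h a 1+a≢s = cong length (filter-none (outDiagonal? (generator _ s h) (3 + a))
      (All.universal (λ { b (e , b≢) → absent e b≢ }) (labels (4 + (s + r)))))
      where
      absent : ∀ {b} → Edge (generator _ s h) (3 + a) b → ¬ (b ≢ 4 + a)
      absent e b≢ with generator-chord₃⁻ s h e
      ... | inj₁ b≡         = b≢ b≡
      ... | inj₂ (1+a≡s , _) = 1+a≢s 1+a≡s

    deg₂-zero : ∀ h → deg 0 h 2 ≡ 1
    deg₂-zero h = count-interval (outDiagonal? (generator _ 0 h) 2) 3 1 r (cong (4 +_) (sym (+-identityʳ r)))
      (λ { b≤3 (side _ , b≢3)      → b≢3 refl
         ; b≤3 (from₂ o _ , b≢3) → b≢3 (≤-antisym b≤3 (proj₁ (proj₂ o))) })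
      (λ 3<b b≤4 → join₂ h (<⇒≤ 3<b) b≤4 , λ { refl → <-irrefl refl 3<b })
      (λ { 4<b (side _ , b≢3)      → b≢3 refl
         ; 4<b (from₂ o b≤4 , b≢3) → <⇒≱ 4<b b≤4 })

    -- The ends counted are 4 to `3 + s` and `5 + s`: the ear `4 + s` is skipped, and 3 is the end
    -- of a side.
    deg₂-suc : ∀ s h → deg (suc s) h 2 ≡ suc s
    deg₂-suc s h = begin
      length (filter P? (labels (5 + (s + r))))
        ≡⟨ cong (length ∘ filter P?) (trans (labels≡span _) (cong (span 0) size)) ⟩
      length (filter P? (span 0 (3 + (s + (1 + (1 + (r + 0)))))))
        ≡⟨ count-none P? 0 3 (s + (1 + (1 + (r + 0)))) refl (λ _ b≤3 p → <⇒≱ (proj₁ (out⁻ p)) b≤3) ⟩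
      length (filter P? (span 3 (s + (1 + (1 + (r + 0))))))
        ≡⟨ count-all P? 3 s _ refl (λ 3<b b≤3+s → out⁺ 3<b (≤-trans b≤3+s (≤-trans (n≤1+n _) (n≤1+n _))) (<⇒≢ (s≤s b≤3+s))) ⟩
      s + length (filter P? (span (3 + s) (1 + (1 + (r + 0)))))
        ≡⟨ cong (s +_) (count-none P? (3 + s) 1 _ (+-comm (3 + s) 1)
             (λ 3+s<b b≤4+s p → proj₂ (proj₂ (out⁻ p)) (≤-antisym b≤4+s 3+s<b))) ⟩
      s + length (filter P? (span (4 + s) (1 + (r + 0))))
        ≡⟨ cong (s +_) (count-all P? (4 + s) 1 _ (+-comm (4 + s) 1)
             (λ 4+s<b b≤5+s → out⁺ (≤-trans (m≤m+n 4 s) (<⇒≤ 4+s<b)) b≤5+s (≢-sym (<⇒≢ 4+s<b)))) ⟩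
      s + (1 + length (filter P? (span (5 + s) (r + 0))))
        ≡⟨ cong (λ m → s + suc m) (count-none P? (5 + s) r 0 refl
             (λ 5+s<b _ p → <⇒≱ 5+s<b (proj₁ (proj₂ (out⁻ p))))) ⟩
      s + 1
        ≡⟨ +-comm s 1 ⟩
      suc s ∎
      where
      open ≡-Reasoning
      T = generator (3 + (s + r)) (suc s) h
      P? = outDiagonal? T 2
      size : 5 + (s + r) ≡ 3 + (s + (1 + (1 + (r + 0))))
      size = cong (3 +_) (trans (cong suc (shift s)) (sym (+-suc s _)))
      out⁻ : ∀ {b} → Edge T 2 b × b ≢ 3 → 3 < b × b ≤ 5 + s × b ≢ 4 + s
      out⁻ (inj₁ (side _ , _) , b≢3) = contradiction refl b≢3
      out⁻ (inj₁ (from₂ o b≤5+s , b≢4+s) , b≢3) =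
        ≤∧≢⇒< (proj₁ (proj₂ o)) (≢-sym b≢3) , b≤5+s , λ { refl → b≢4+s refl }
      out⁺ : ∀ {b} → 3 < b → b ≤ 5 + s → b ≢ 4 + s → Edge T 2 b × b ≢ 3
      out⁺ 3<b b≤5+s b≢4+s =
        inj₁ (join₂ h (<⇒≤ 3<b) b≤5+s , λ { refl → b≢4+s refl }) , ≢-sym (<⇒≢ 3<b)

    deg₃-throughout : ∀ s h {a a′} → 2 ≤ a → (∀ {j} → a < 3 + j → 3 + j ≤ a′ → suc j ≢ s) →
      Throughout (λ b → deg s h b ≡ 0) a a′
    deg₃-throughout s h 2≤a ok {suc (suc (suc j))} a<b b≤a′ = deg₃ s h j (ok a<b b≤a′)
    deg₃-throughout s h 2≤a ok {zero} () b≤a′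
    deg₃-throughout s h 2≤a ok {suc zero} a<1 b≤a′ = contradiction (≤-<-trans 2≤a a<1) λ { (s≤s ()) }
    deg₃-throughout s h 2≤a ok {suc (suc zero)} a<2 b≤a′ = contradiction (≤-<-trans 2≤a a<2) λ { (s≤s (s≤s ())) }

  D-generator : ∀ s h → D (2 + (s + r)) (generator (2 + (s + r)) s h) ≡ outdegrees s r
  D-generator zero h = trans
    (cong (map (deg 0 h)) (trans (labels≡span (2 + r)) (cong (span 0) (cong (2 +_) (sym (+-identityʳ r))))))
    (cong₂ _∷_ (deg₁ 0 h) (cong₂ _∷_ (deg₂-zero h)
      (map-zeros (deg 0 h) 2 r 0 refl (deg₃-throughout 0 h ≤-refl λ _ _ ()))))
  D-generator (suc s) h = trans
    (cong (map (deg (suc s) h)) (trans (labels≡span (3 + (s + r)))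
      (cong (span 0) (cong (2 +_) (shift s)))))
    (cong₂ _∷_ (deg₁ (suc s) h) (cong₂ _∷_ (deg₂-suc s h) (trans
      (map-zeros (deg (suc s) h) 2 s (1 + (r + 0)) refl (deg₃-throughout (suc s) h ≤-refl
        λ _ 3+j≤2+s 1+j≡1+s → <⇒≢ (≤-pred (≤-pred 3+j≤2+s)) (suc-injective 1+j≡1+s)))
      (cong (replicate s 0 ++_) (cong₂ _∷_ (deg-ear s h)
        (map-zeros (deg (suc s) h) (3 + s) r 0 refl (deg₃-throughout (suc s) h (s≤s (s≤s z≤n))
          λ 3+s<3+j _ 1+j≡1+s → <⇒≢ (≤-pred (≤-pred (≤-pred 3+s<3+j))) (sym (suc-injective 1+j≡1+s)))))))))

-- Outdegrees of the matchings.

module _ (s r : ℕ) where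

  private
    i = suc r
    -- This is `2n - i`, the tail of the short edge in the bottom row.
    i′ = 3 + (s + (s + r))
    M = u (2 + (s + r)) i
    f = Graph.outdegree M

    double : ∀ s r → 2 * (2 + (s + r)) ≡ suc r + (3 + (s + (s + r)))
    double = solve-∀

    mirror : 2 * (2 + (s + r)) ∸ i ≡ i′
    mirror = trans (cong (_∸ i) (double s r)) (m+n∸m≡n i i′)

    n<i′ : 2 + (s + r) < i′
    n<i′ = s≤s (s≤s (s≤s (m≤n+m (s + r) s)))

    outdegree-pos : ∀ {a b} → Graph.Edge M a b → 1 ≤ b → b ≤ 2 * (2 + (s + r)) → 0 < f a
    outdegree-pos {a} ab 1≤b b≤2n = ∈-length (∈-filter⁺ (Graph.edge? M a) (∈-labels 1≤b b≤2n) ab)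

    outdegree-top : ∀ {a} → 1 ≤ a → a ≤ 2 + (s + r) → a ≢ i + 1 → 0 < f a
    outdegree-top {a} 1≤a a≤n a≢i+1 = by-cases (a ≟ i)
      where
      by-cases : Dec (a ≡ i) → 0 < f a
      by-cases (yes a≡i) = outdegree-pos (inj₁ (a≡i , refl)) z<s
        (+-mono-≤ (≤-trans (m≤n+m i s) (≤-trans (≤-reflexive (+-suc s r)) (n≤1+n _))) z<s)
      by-cases (no a≢i)  = outdegree-pos (inj₂ (inj₂ (1≤a , a≤n , a≢i , a≢i+1 , refl)))
        (m<n⇒0<n∸m (≤-<-trans a≤n (≤-<-trans (m≤m+n _ _) (m<m+n _ z<s))))
        (≤-trans (∸-monoʳ-≤ (2 * (2 + (s + r)) + 1) 1≤a) (≤-reflexive (m+n∸n≡m _ 1)))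

    outdegree-mirror : 0 < f i′
    outdegree-mirror = outdegree-pos (inj₂ (inj₁ (sym mirror , cong (_+ 1) (sym mirror)))) z<s
      (≤-trans (+-monoʳ-≤ i′ (s≤s (z≤n {r}))) (≤-reflexive (trans (+-comm i′ i) (sym (double s r)))))

    outdegree-zero : ∀ {a} → a ≢ i → a ≢ i′ → (a ≡ i + 1 ⊎ 2 + (s + r) < a) → f a ≡ 0
    outdegree-zero {a} a≢i a≢i′ where? = cong length (filter-none (Graph.edge? M a)
      (All.universal (λ _ → absent where?) (labels (2 * (2 + (s + r))))))
      where
      absent : ∀ {b} → (a ≡ i + 1 ⊎ 2 + (s + r) < a) → ¬ Graph.Edge M a b
      absent _ (inj₁ (a≡i , _)) = a≢i a≡i
      absent _ (inj₂ (inj₁ (a≡ , _))) = a≢i′ (trans a≡ mirror)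
      absent (inj₁ a≡i+1) (inj₂ (inj₂ (_ , _ , _ , a≢i+1 , _))) = a≢i+1 a≡i+1
      absent (inj₂ n<a)   (inj₂ (inj₂ (_ , a≤n , _)))           = <⇒≱ n<a a≤n

    blocks : ∀ s r → 2 * (2 + (s + r)) ≡ suc r + (1 + (s + (s + (1 + (suc r + 0)))))
    blocks = solve-∀

  bottom-zero : ∀ {a} → 2 + (s + r) < a → a ≢ i′ → f a ≡ 0
  bottom-zero n<a a≢i′ = outdegree-zero (≢-sym (<⇒≢ (≤-<-trans (s≤s (≤-trans (m≤n+m r s) (n≤1+n _))) n<a)))
    a≢i′ (inj₂ n<a)

  mirror-run : runsFrom 0 (map f (span (2 + (s + (s + r))) (1 + (suc r + 0)))) ≡ 1 ∷ replicate r 0 ++ []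
  mirror-run = trans
    (runsFrom-ones f 0 _ 1 (suc r + 0) (+-comm _ 1)
      λ i′≤a a≤i′ → subst (λ a → 0 < f a) (≤-antisym i′≤a a≤i′) outdegree-mirror)
    (runsFrom-zeros f 1 i′ r 0 (+-comm i′ (suc r))
      λ i′<a _ → bottom-zero (<-trans n<i′ i′<a) (≢-sym (<⇒≢ i′<a)))

  -- In order, `B` has `i` ones, the zero at `i + 1`, `s` ones up to `n`, `s` zeros, the one at `i′`
  -- and `i` zeros. The run of `s` ones is left open, since for `s = 0` the one at `i′` continues
  -- it.
  top-runs : runs (B M) ≡ suc r ∷ runsFrom s (map f (span (2 + (s + r)) (s + (1 + (suc r + 0)))))
  top-runs = begin
    runs (map f (labels (2 * (2 + (s + r)))))
      ≡⟨ cong (runs ∘ map f) (trans (labels≡span _) (cong (span 0) (blocks s r))) ⟩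
    runs (map f (span 0 (suc r + (1 + (s + (s + (1 + (suc r + 0))))))))
      ≡⟨ runsFrom-ones f 0 0 (suc r) _ refl (λ 0<a a≤i →
           outdegree-top 0<a (≤-trans a≤i i≤n) (<⇒≢ (≤-<-trans a≤i i<i+1))) ⟩
    runsFrom (suc r) (map f (span (suc r) (1 + (s + (s + (1 + (suc r + 0)))))))
      ≡⟨ runsFrom-zeros f (suc r) (suc r) 0 _ (+-comm (suc r) 1) (λ i<a a≤1+i →
           outdegree-zero (≢-sym (<⇒≢ i<a)) (<⇒≢ (≤-<-trans (≤-trans a≤1+i 1+i≤n) n<i′))
             (inj₁ (trans (≤-antisym a≤1+i i<a) (+-comm 1 i)))) ⟩
    suc r ∷ runsFrom 0 (map f (span (2 + r) (s + (s + (1 + (suc r + 0))))))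
      ≡⟨ cong (suc r ∷_) (runsFrom-ones f 0 (2 + r) s _ (cong (2 +_) (+-comm r s)) (λ 1+i<a a≤n →
           outdegree-top (≤-trans z<s 1+i<a) a≤n (≢-sym (<⇒≢ (≤-<-trans (≤-reflexive (+-comm i 1)) 1+i<a))))) ⟩
    suc r ∷ runsFrom s (map f (span (2 + (s + r)) (s + (1 + (suc r + 0)))))
      ∎
    where
    open ≡-Reasoning
    i<i+1 : i < i + 1
    i<i+1 = m<m+n i z<s
    1+i≤n : 2 + r ≤ 2 + (s + r)
    1+i≤n = s≤s (s≤s (m≤n+m r s))
    i≤n : i ≤ 2 + (s + r)
    i≤n = <⇒≤ 1+i≤n

runs-B-u : ∀ s r → runs (B (u (2 + (s + r)) (suc r))) ≡ outdegrees s r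
runs-B-u zero    r = trans (top-runs 0 r) (cong (suc r ∷_) (mirror-run 0 r))
runs-B-u (suc s) r = trans (top-runs (suc s) r) (cong (suc r ∷_) (trans
  (runsFrom-zeros (Graph.outdegree (u (3 + (s + r)) (suc r))) (suc s) (3 + (s + r)) s (1 + (suc r + 0))
    (end s r)
    λ n<a a≤ → bottom-zero (suc s) r n<a (<⇒≢ (s≤s a≤)))
  (cong (λ bs → suc s ∷ replicate s 0 ++ bs) (mirror-run (suc s) r))))
  where
  end : ∀ s r → 3 + (s + r) + suc s ≡ 2 + (suc s + (suc s + r))
  end = solve-∀

-- Flip distances in terms of the indices.

generatorTriangulation : ∀ {n i s} → 1 ≤ i → i + suc s ≡ n → suc s < n → TheTriangulationOf n (u n i)
generatorTriangulation {n} {i} {s} 1≤i i+1+s≡n h = generator n s h , corresponds 1≤i i+1+s≡n h ,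
  λ {T} DT≡ → D-injective (generator n s h) T (trans (corresponds 1≤i i+1+s≡n h) (sym DT≡))
  where
  corresponds : ∀ {n i s} → 1 ≤ i → i + suc s ≡ n → (h : suc s < n) → Corresponds n (u n i) (generator n s h)
  corresponds {n} {suc r} {s} _ r+2+s≡n h with trans (sym r+2+s≡n) (cong suc (trans (+-suc r s) (cong suc (+-comm r s))))
  ... | refl = trans (D-generator r s h) (sym (runs-B-u s r))

-- As `s` belongs to the larger index `j`, the smaller index `i` has `k + s`. Symmetry turns the
-- upward formulas into the downward ones.
distance-both : ∀ {n i j k s m} → 1 ≤ i → j ≡ i + k → j + suc s ≡ n →
  (∀ h h′ → FlipDistance (generator n (k + s) h) (generator n s h′) m) →
  d[ n ]⟨ i , j ⟩≡ m × d[ n ]⟨ j , i ⟩≡ m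
distance-both {n} {i} {j} {k} {s} 1≤i refl j+1+s≡n dist =
  (Tᵢ , Tⱼ , dist hᵢ hⱼ) , (Tⱼ , Tᵢ , FlipDistance-sym {T = proj₁ Tᵢ} {proj₁ Tⱼ} (dist hᵢ hⱼ))
  where
  i+1+k+s≡n : i + suc (k + s) ≡ n
  i+1+k+s≡n = trans (cong (i +_) (sym (+-suc k s))) (trans (sym (+-assoc i k (suc s))) j+1+s≡n)
  hᵢ : suc (k + s) < n
  hᵢ = <-≤-trans (+-monoˡ-< (suc (k + s)) 1≤i) (≤-reflexive i+1+k+s≡n)
  hⱼ : suc s < n
  hⱼ = ≤-<-trans (s≤s (m≤n+m s k)) hᵢ
  Tᵢ = generatorTriangulation 1≤i i+1+k+s≡n hᵢ
  Tⱼ = generatorTriangulation (≤-trans 1≤i (m≤m+n i k)) j+1+s≡n hⱼ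

gap : ∀ {j n} → j < n → ∃ λ s → j + suc s ≡ n
gap {j} j<n = let s , eq = m≤n⇒∃[o]m+o≡n j<n in s , trans (+-suc j s) eq

module _ {n i j : ℕ} (1≤i : 1 ≤ i) (j<n : j < n) where

  -- The exceptional case is the same in both directions: the larger index is `n - 1`, that is,
  -- `s = 0`.
  adjacent : j ≡ i + 1 →
    (j + 1 ≢ n → d[ n ]⟨ i , j ⟩≡ 3 × d[ n ]⟨ j , i ⟩≡ 3) ×
    (j + 1 ≡ n → d[ n ]⟨ i , j ⟩≡ 2 × d[ n ]⟨ j , i ⟩≡ 2)
  adjacent j≡i+1 with gap j<n
  ... | zero  , eq = (λ j+1≢n → contradiction eq j+1≢n) ,
                     λ _ → distance-both 1≤i j≡i+1 eq distance₁-last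
  ... | suc s , eq = (λ _ → distance-both 1≤i j≡i+1 eq (distance₁ s)) ,
                     λ j+1≡n → contradiction (+-cancelˡ-≡ j _ _ (trans j+1≡n (sym eq))) λ ()

  distant : ∀ {k} → 2 ≤ k → j ≡ i + k →
    (j + 1 ≢ n → d[ n ]⟨ i , j ⟩≡ (k + 1) × d[ n ]⟨ j , i ⟩≡ (k + 1)) ×
    (j + 1 ≡ n → d[ n ]⟨ i , j ⟩≡ k × d[ n ]⟨ j , i ⟩≡ k)
  distant {suc (suc k)} (s≤s (s≤s _)) j≡i+k with gap j<n
  ... | zero  , eq = (λ j+1≢n → contradiction eq j+1≢n) ,
                     λ _ → distance-both 1≤i j≡i+k eq (distance-last k)
  ... | suc s , eq rewrite +-comm k 1 =
                     (λ _ → distance-both 1≤i j≡i+k eq (distance k s)) ,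
                     λ j+1≡n → contradiction (+-cancelˡ-≡ j _ _ (trans j+1≡n (sym eq))) λ ()

proposition15 : ∀ (n i k : ℕ) → 1 ≤ i → i < n → 2 ≤ k →
    (i + 1 < n →
    (i + 2 ≢ n → d[ n ]⟨ i , i + 1 ⟩≡ 3) ×
    (i + 2 ≡ n → d[ n ]⟨ i , i + 1 ⟩≡ 2)) ×
    (i + k < n →
    (i + k + 1 ≢ n → d[ n ]⟨ i , i + k ⟩≡ (k + 1)) ×
    (i + k + 1 ≡ n → d[ n ]⟨ i , i + k ⟩≡ k)) ×
    (1 < i →
    (i + 1 ≢ n → d[ n ]⟨ i , i ∸ 1 ⟩≡ 3) ×
    (i + 1 ≡ n → d[ n ]⟨ i , i ∸ 1 ⟩≡ 2)) ×
    (k < i →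
    (i + 1 ≢ n → d[ n ]⟨ i , i ∸ k ⟩≡ (k + 1)) ×
    (i + 1 ≡ n → d[ n ]⟨ i , i ∸ k ⟩≡ k))
proposition15 n i k 1≤i i<n 2≤k =
    (λ i+1<n → let generic , last = adjacent 1≤i i+1<n refl in
        (λ i+2≢n → proj₁ (generic (i+2≢n ∘ trans (sym (+-assoc i 1 1)))))
      , (λ i+2≡n → proj₁ (last (trans (+-assoc i 1 1) i+2≡n))))
  , (λ i+k<n → let generic , last = distant 1≤i i+k<n 2≤k refl in proj₁ ∘ generic , proj₁ ∘ last)
  -- Going down, `i` is the larger index and `i ∸ 1` the smaller.
  , (λ 1<i → let generic , last = adjacent (m<n⇒0<n∸m 1<i) i<n (sym (m∸n+n≡m 1≤i)) in
      proj₂ ∘ generic , proj₂ ∘ last)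
  , (λ k<i → let generic , last = distant (m<n⇒0<n∸m k<i) i<n 2≤k (sym (m∸n+n≡m (<⇒≤ k<i))) in
      proj₂ ∘ generic , proj₂ ∘ last)
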